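{- Let $a,b$ be relatively prime integers with $1<a<b$, let $S=\langle a,b\rangle$, and let $(u,v)$ be the definitely least solution of $ax+by=1$. Then $\#T(S)=|uv|$, where $T(S)=\{s\in S: s<F(S),\ s-1\notin S,\ s+1\notin S\}$.
   Context: $\langle a,b\rangle=\{\lambda_1a+\lambda_2b:\lambda_1,\lambda_2\in\mathbb{N}\}$, $\mathbb{N}$ the nonnegative integers. $F(S)$ is the Frobenius number of $S$ (largest integer not in $S$). A solution $(u,v)\in\mathbb{Z}^2$ of $ax+by=1$ is the definitely least solution if both $|u|$ and $|v|$ attain their least possible values among all integer solutions; it is unique, and is the unique solution with $|u|\le b/2$, $|v|\le a/2$. -}

module Defs where

open import Data.Nat as ℕ using (ℕ)
open import Data.Integer using (ℤ; +_; _+_; _-_; _*_; _<_; _>_; ∣_∣)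
open import Data.Product using (Σ; ∃; ∃-syntax; _×_; _,_)
open import Data.List using (List; length)
open import Data.List.Membership.Propositional using (_∈_)
open import Data.List.Relation.Unary.Unique.Propositional using (Unique)
open import Relation.Binary.PropositionalEquality using (_≡_)
open import Relation.Nullary using (¬_)
open import Function.Bundles using (_⇔_)

-- membership in the numerical semigroup S = ⟨a,b⟩ (subset of ℤ)
InS : ℕ → ℕ → ℤ → Set
InS a b n = ∃[ l₁ ] ∃[ l₂ ] (+ l₁ * + a + + l₂ * + b ≡ n)

-- f is the Frobenius number of ⟨a,b⟩: largest integer not in S
IsFrobenius : ℕ → ℕ → ℤ → Set
IsFrobenius a b f = ¬ InS a b f × (∀ n → n > f → InS a b n)

-- (u,v) is the definitely least solution of a x + b y = 1:
-- both |u| and |v| attain their least possible values among all integer solutions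
DefinitelyLeast : ℕ → ℕ → ℤ → ℤ → Set
DefinitelyLeast a b u v =
  (+ a * u + + b * v ≡ + 1) ×
  (∀ x y → + a * x + + b * y ≡ + 1 → (∣ u ∣ ℕ.≤ ∣ x ∣) × (∣ v ∣ ℕ.≤ ∣ y ∣))

-- T(S) = { s ∈ S : s < F(S), s-1 ∉ S, s+1 ∉ S }, with F the Frobenius number
InT : ℕ → ℕ → ℤ → ℤ → Set
InT a b F s = InS a b s × s < F × ¬ InS a b (s - + 1) × ¬ InS a b (s + + 1)

-- a predicate on ℤ has (finite) cardinality k
HasCard : (ℤ → Set) → ℕ → Set
HasCard P k = ∃[ L ] (Unique L × (∀ x → (x ∈ L) ⇔ P x) × length L ≡ k)

{-# OPTIONS --safe #-}
module Submission where

-- Comparing (u, v) with the solutions (u ∓ b, v ± a) gives 2|u| ≤ b and 2|v| ≤ a, and since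
-- a, b > 1 the signs of u and v differ. So, writing (p, m, q, k) for (a, |u|, b, |v|) or for
-- (b, |v|, a, |u|), we have p m = 1 + q k, 2m ≤ q and 2k ≤ p, and the isolated elements of S
-- below F are exactly the s = x p + y q with x < m and y < k. If y ≥ k or x ≥ m, then
-- s + 1 = (x + m) p + (y - k) q or s - 1 = (x - m) p + (y + k) q lies in S. If x < m and
-- y < k, compare s + 1 + k q = (x + m) p + y q and s - 1 + m p = x p + (y + k) q with other
-- representations: by coprimality, a representation c p + y q with c < q has the least
-- q-coefficient among all representations of its value. The same fact makes the
-- representations x p + y q with y < k ≤ p unique, so there are m k of them.

open import Defs
open import Data.Nat using (ℕ; _<_)
open import Data.Nat.Coprimality using (Coprime)
open import Data.Integer using (ℤ; _*_; ∣_∣)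

open import Data.Nat using (zero; suc; _+_; _∸_; _≤_; z<s; NonZero; >-nonZero) renaming (_*_ to _·_)
open import Data.Nat.Properties
open import Data.Nat.Coprimality using (coprime-divisor) renaming (sym to coprime-sym)
open import Data.Nat.Divisibility using (_∣_; divides; >⇒∤)
open import Data.Nat.Tactic.RingSolver using (solve)
open import Data.Integer using (+_; -[1+_]; _⊖_; +<+)
import Data.Integer as ℤ
import Data.Integer.Properties as ℤ
open import Data.Integer.Tactic.RingSolver using (solve-∀)
import Data.Sign as Sign
open import Data.Fin using (Fin; toℕ; fromℕ<)
open import Data.Fin.Properties using (toℕ<n; toℕ-fromℕ<; toℕ-injective)
open import Data.List using (List; []; _∷_; length; map; cartesianProductWith; allFin)
open import Data.List.Properties using (length-++; length-map; length-tabulate)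
open import Data.List.Membership.Propositional using (_∈_)
open import Data.List.Membership.Propositional.Properties
  using (∈-cartesianProductWith⁺; ∈-cartesianProductWith⁻; ∈-allFin)
import Data.List.Relation.Unary.Unique.Propositional.Properties as Unique
open import Data.Product using (_×_; _,_; proj₁; proj₂; ∃₂; ∃-syntax)
open import Data.Sum using (_⊎_; inj₁; inj₂)
open import Function using (id; _∘_)
open import Function.Bundles using (_⇔_; mk⇔; Equivalence)
import Function.Properties.Equivalence as ⇔
open import Relation.Binary.PropositionalEquality
open import Relation.Nullary using (¬_; contradiction; yes; no)

open Equivalence using (to; from)

Representable : ℕ → ℕ → ℕ → Set
Representable p q n = ∃₂ λ x y → x · p + y · q ≡ n

∣∧<⇒≡0 : ∀ {d n} → d ∣ n → n < d → n ≡ 0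
∣∧<⇒≡0 {n = zero}  _   _   = refl
∣∧<⇒≡0 {n = suc _} d∣n n<d = contradiction d∣n (>⇒∤ n<d)

coefficient-bound : ∀ {p q c y l n} → Coprime p q → c < q →
                    c · p + y · q ≡ l · p + n · q → n ≤ y
coefficient-bound {p} {q} {c} {y} {l} {n} coprime c<q eq =
  m∸n≡0⇒m≤n (m*n≡0⇒m≡0 (n ∸ y) q {{>-nonZero (m<n⇒0<n c<q)}} [n∸y]q≡0)
  where
  open ≡-Reasoning
  [n∸y]q≡[c∸l]p : (n ∸ y) · q ≡ (c ∸ l) · p
  [n∸y]q≡[c∸l]p = begin
    (n ∸ y) · q                       ≡⟨ *-distribʳ-∸ q n y ⟩
    n · q ∸ y · q                     ≡⟨ [m+n]∸[m+o]≡n∸o (l · p) (n · q) (y · q) ⟨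
    (l · p + n · q) ∸ (l · p + y · q) ≡⟨ cong (_∸ (l · p + y · q)) eq ⟨
    (c · p + y · q) ∸ (l · p + y · q) ≡⟨ cong₂ _∸_ (+-comm (c · p) (y · q)) (+-comm (l · p) (y · q)) ⟩
    (y · q + c · p) ∸ (y · q + l · p) ≡⟨ [m+n]∸[m+o]≡n∸o (y · q) (c · p) (l · p) ⟩
    c · p ∸ l · p                     ≡⟨ *-distribʳ-∸ p c l ⟨
    (c ∸ l) · p                       ∎
  c∸l≡0 : c ∸ l ≡ 0
  c∸l≡0 = ∣∧<⇒≡0 (coprime-divisor (coprime-sym coprime)
                    (divides (n ∸ y) (trans (*-comm p (c ∸ l)) (sym [n∸y]q≡[c∸l]p))))
                 (≤-<-trans (m∸n≤m c l) c<q)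
  [n∸y]q≡0 : (n ∸ y) · q ≡ 0
  [n∸y]q≡0 = trans [n∸y]q≡[c∸l]p (cong (_· p) c∸l≡0)

combination-injective : ∀ {p q x₁ y₁ x₂ y₂} .{{_ : NonZero q}} → Coprime p q → y₁ < p → y₂ < p →
                        x₁ · p + y₁ · q ≡ x₂ · p + y₂ · q → x₁ ≡ x₂ × y₁ ≡ y₂
combination-injective {p} {q} {x₁} {y₁} {x₂} {y₂} coprime y₁<p y₂<p eq = x₁≡x₂ , y₁≡y₂
  where
  x₁≡x₂ : x₁ ≡ x₂
  x₁≡x₂ = ≤-antisym
    (coefficient-bound {l = y₁} (coprime-sym coprime) y₂<p
      (trans (+-comm (y₂ · q) (x₂ · p)) (trans (sym eq) (+-comm (x₁ · p) (y₁ · q)))))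
    (coefficient-bound {l = y₂} (coprime-sym coprime) y₁<p
      (trans (+-comm (y₁ · q) (x₁ · p)) (trans eq (+-comm (x₂ · p) (y₂ · q)))))
  y₁≡y₂ : y₁ ≡ y₂
  y₁≡y₂ = *-cancelʳ-≡ y₁ y₂ q
            (+-cancelˡ-≡ (x₁ · p) _ _ (trans eq (cong (λ x → x · p + y₂ · q) (sym x₁≡x₂))))

pos-combination : ∀ p q x y → + x * + p ℤ.+ + y * + q ≡ + (x · p + y · q)
pos-combination p q x y = cong₂ ℤ._+_ (sym (ℤ.pos-* x p)) (sym (ℤ.pos-* y q))

InS⇒representation : ∀ {p q s} → InS p q s → ∃₂ λ x y → s ≡ + (x · p + y · q)
InS⇒representation {p} {q} (x , y , eq) = x , y , trans (sym eq) (pos-combination p q x y)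

InS-+ : ∀ {p q n} → InS p q (+ n) ⇔ Representable p q n
InS-+ {p} {q} = mk⇔
  (λ (x , y , eq) → x , y , ℤ.+-injective (trans (sym (pos-combination p q x y)) eq))
  (λ (x , y , eq) → x , y , trans (pos-combination p q x y) (cong +_ eq))

InS-suc : ∀ {p q n} → InS p q (+ n ℤ.+ + 1) ⇔ Representable p q (suc n)
InS-suc {p} {q} {n} = subst (λ t → InS p q (+ (n + 1)) ⇔ Representable p q t) (+-comm n 1) InS-+

InS-pred : ∀ {p q n} → InS p q (+ n ℤ.- + 1) ⇔ (∃[ j ] Representable p q j × suc j ≡ n)
InS-pred {n = zero}  = mk⇔ (λ s∈S → contradiction (proj₂ (proj₂ (InS⇒representation s∈S))) λ ())
                           λ { (_ , _ , ()) }
InS-pred {n = suc j} = mk⇔ (λ s∈S → j , to InS-+ s∈S , refl)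
                           λ { (_ , j∈S , refl) → from InS-+ j∈S }

InS-comm : ∀ {p q s} → InS p q s → InS q p s
InS-comm {p} {q} (x , y , eq) = y , x , trans (ℤ.+-comm (+ y * + q) (+ x * + p)) eq

InT-comm : ∀ {p q F s} → InT p q F s → InT q p F s
InT-comm (s∈S , s<F , pred∉S , suc∉S) = InS-comm s∈S , s<F , pred∉S ∘ InS-comm , suc∉S ∘ InS-comm

IsFrobenius-comm : ∀ {p q F} → IsFrobenius p q F → IsFrobenius q p F
IsFrobenius-comm (F∉S , above-F∈S) = F∉S ∘ InS-comm , λ s s>F → InS-comm (above-F∈S s s>F)

below-Frobenius : ∀ {p q F s} → IsFrobenius p q F → ¬ InS p q (s ℤ.+ + 1) → s ℤ.< F
below-Frobenius {F = F} {s} (_ , above-F∈S) suc∉S with s ℤ.<? F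
... | yes s<F = s<F
... | no  s≮F = contradiction (above-F∈S (s ℤ.+ + 1) (ℤ.≤-<-trans (ℤ.≮⇒≥ s≮F) (i<i+1 s))) suc∉S
  where
  i<i+1 : ∀ i → i ℤ.< i ℤ.+ + 1
  i<i+1 i = subst (ℤ._< i ℤ.+ + 1) (ℤ.+-identityʳ i) (ℤ.+-monoʳ-< i (+<+ z<s))

length-cartesianProductWith : ∀ {A B C : Set} (f : A → B → C) xs ys →
                              length (cartesianProductWith f xs ys) ≡ length xs · length ys
length-cartesianProductWith f []       ys = refl
length-cartesianProductWith f (x ∷ xs) ys =
  trans (length-++ (map (f x) ys))
        (cong₂ _+_ (length-map (f x) ys) (length-cartesianProductWith f xs ys))

HasCard-cong : ∀ {P Q : ℤ → Set} {n} → (∀ s → P s ⇔ Q s) → HasCard P n → HasCard Q n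
HasCard-cong P⇔Q (L , unique , ∈L⇔P , length≡n) =
  L , unique , (λ s → ⇔.trans (∈L⇔P s) (P⇔Q s)) , length≡n

HasCard-image : ∀ {m k} {P : ℤ → Set} (f : Fin m → Fin k → ℤ) →
                (∀ {i i′ j j′} → f i j ≡ f i′ j′ → i ≡ i′ × j ≡ j′) →
                (∀ s → P s ⇔ (∃₂ λ i j → f i j ≡ s)) → HasCard P (m · k)
HasCard-image {m} {k} f f-injective P⇔image =
  image , Unique.cartesianProductWith⁺ f f-injective (Unique.allFin⁺ m) (Unique.allFin⁺ k) ,
  (λ s → ⇔.trans (∈image⇔ s) (⇔.sym (P⇔image s))) ,
  trans (length-cartesianProductWith f (allFin m) (allFin k))
        (cong₂ _·_ (length-tabulate {n = m} id) (length-tabulate {n = k} id))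
  where
  image : List ℤ
  image = cartesianProductWith f (allFin m) (allFin k)
  ∈image⇔ : ∀ s → s ∈ image ⇔ (∃₂ λ i j → f i j ≡ s)
  ∈image⇔ s = mk⇔
    (λ s∈image → let i , j , _ , _ , s≡fij = ∈-cartesianProductWith⁻ f (allFin m) (allFin k) s∈image
                 in i , j , sym s≡fij)
    λ { (i , j , refl) → ∈-cartesianProductWith⁺ f (∈-allFin i) (∈-allFin j) }

module BalancedBezout {p q m k : ℕ} (coprime : Coprime p q) (bezout : p · m ≡ suc (q · k))
                      (2m≤q : m + m ≤ q) (2k≤p : k + k ≤ p) where

  open ≡-Reasoning

  suc-unrepresentable : ∀ {x y} → x < m → y < k → ¬ Representable p q (suc (x · p + y · q))
  suc-unrepresentable {x} {y} x<m y<k (l₁ , l₂ , eq) =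
    <⇒≱ y<k (≤-trans (m≤n+m k l₂) (coefficient-bound {l = l₁} coprime x+m<q shifted))
    where
    x+m<q : x + m < q
    x+m<q = <-≤-trans (+-monoˡ-< m x<m) 2m≤q
    shifted : (x + m) · p + y · q ≡ l₁ · p + (l₂ + k) · q
    shifted = begin
      (x + m) · p + y · q            ≡⟨ solve (x ∷ m ∷ p ∷ y ∷ q ∷ []) ⟩
      (x · p + y · q) + p · m        ≡⟨ cong (λ t → x · p + y · q + t) bezout ⟩
      (x · p + y · q) + suc (q · k)  ≡⟨ +-suc (x · p + y · q) (q · k) ⟩
      suc (x · p + y · q) + q · k    ≡⟨ cong (_+ q · k) eq ⟨
      (l₁ · p + l₂ · q) + q · k      ≡⟨ solve (l₁ ∷ p ∷ l₂ ∷ q ∷ k ∷ []) ⟩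
      l₁ · p + (l₂ + k) · q          ∎

  pred-unrepresentable : ∀ {x y n} → x < m → y < k → Representable p q n → suc n ≢ x · p + y · q
  pred-unrepresentable {x} {y} x<m y<k (l₁ , l₂ , refl) eq =
    <⇒≱ x<m (≤-trans (m≤n+m m l₁) (coefficient-bound {l = l₂} (coprime-sym coprime) y+k<p shifted))
    where
    y+k<p : y + k < p
    y+k<p = <-≤-trans (+-monoˡ-< k y<k) 2k≤p
    shifted : (y + k) · q + x · p ≡ l₂ · q + (l₁ + m) · p
    shifted = suc-injective (begin
      suc ((y + k) · q + x · p)       ≡⟨ solve (y ∷ k ∷ q ∷ x ∷ p ∷ []) ⟩
      (x · p + y · q) + suc (q · k)   ≡⟨ cong (λ t → x · p + y · q + t) bezout ⟨
      (x · p + y · q) + p · m         ≡⟨ cong (_+ p · m) eq ⟨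
      suc (l₁ · p + l₂ · q) + p · m   ≡⟨ solve (l₁ ∷ p ∷ l₂ ∷ q ∷ m ∷ []) ⟩
      suc (l₂ · q + (l₁ + m) · p)     ∎)

  suc-representable : ∀ {x y} → k ≤ y → Representable p q (suc (x · p + y · q))
  suc-representable {x} k≤y with d , refl ← m≤n⇒∃[o]m+o≡n k≤y = x + m , d , (begin
    (x + m) · p + d · q             ≡⟨ solve (x ∷ m ∷ p ∷ d ∷ q ∷ []) ⟩
    (x · p + d · q) + p · m         ≡⟨ cong (λ t → x · p + d · q + t) bezout ⟩
    (x · p + d · q) + suc (q · k)   ≡⟨ solve (x ∷ p ∷ d ∷ q ∷ k ∷ []) ⟩
    suc (x · p + (k + d) · q)       ∎)

  pred-representable : ∀ {x y} → m ≤ x → ∃[ n ] Representable p q n × suc n ≡ x · p + y · q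
  pred-representable {y = y} m≤x with d , refl ← m≤n⇒∃[o]m+o≡n m≤x =
    d · p + (y + k) · q , (d , y + k , refl) , (begin
    suc (d · p + (y + k) · q)        ≡⟨ solve (d ∷ p ∷ y ∷ k ∷ q ∷ []) ⟩
    (d · p + y · q) + suc (q · k)    ≡⟨ cong (λ t → d · p + y · q + t) bezout ⟨
    (d · p + y · q) + p · m          ≡⟨ solve (d ∷ p ∷ y ∷ q ∷ m ∷ []) ⟩
    (m + d) · p + y · q              ∎)

  grid : Fin m → Fin k → ℤ
  grid i j = + (toℕ i · p + toℕ j · q)

  q-nonZero : NonZero q
  q-nonZero = >-nonZero (<-≤-trans (n≢0⇒n>0 m≢0) (≤-trans (m≤m+n m m) 2m≤q))
    where
    m≢0 : m ≢ 0
    m≢0 m≡0 = 0≢1+n (trans (sym (trans (cong (p ·_) m≡0) (*-zeroʳ p))) bezout)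

  <k⇒<p : ∀ {y} → y < k → y < p
  <k⇒<p y<k = <-≤-trans y<k (≤-trans (m≤m+n k k) 2k≤p)

  grid-injective : ∀ {i i′ j j′} → grid i j ≡ grid i′ j′ → i ≡ i′ × j ≡ j′
  grid-injective {j = j} {j′} eq =
    let x≡x′ , y≡y′ = combination-injective {{q-nonZero}} coprime
                        (<k⇒<p (toℕ<n j)) (<k⇒<p (toℕ<n j′)) (ℤ.+-injective eq)
    in toℕ-injective x≡x′ , toℕ-injective y≡y′

  grid-isolated : ∀ i j → ¬ InS p q (grid i j ℤ.- + 1) × ¬ InS p q (grid i j ℤ.+ + 1)
  grid-isolated i j =
    (λ pred∈S → let n , n∈S , suc-n≡ = to InS-pred pred∈S
                in pred-unrepresentable (toℕ<n i) (toℕ<n j) n∈S suc-n≡) ,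
    (λ suc∈S → suc-unrepresentable (toℕ<n i) (toℕ<n j) (to InS-suc suc∈S))

  isolated-on-grid : ∀ x y → let s = + (x · p + y · q) in
                     ¬ InS p q (s ℤ.- + 1) → ¬ InS p q (s ℤ.+ + 1) → ∃₂ λ i j → grid i j ≡ s
  isolated-on-grid x y pred∉S suc∉S =
    fromℕ< x<m , fromℕ< y<k , cong₂ (λ x y → + (x · p + y · q)) (toℕ-fromℕ< x<m) (toℕ-fromℕ< y<k)
    where
    x<m : x < m
    x<m = ≰⇒> λ m≤x → pred∉S (from InS-pred (pred-representable {y = y} m≤x))
    y<k : y < k
    y<k = ≰⇒> λ k≤y → suc∉S (from InS-suc (suc-representable {x} k≤y))

  InT⇔grid : ∀ {F} → IsFrobenius p q F → ∀ s → InT p q F s ⇔ (∃₂ λ i j → grid i j ≡ s)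
  InT⇔grid {F} frobenius s = mk⇔ on-grid isolated
    where
    on-grid : InT p q F s → ∃₂ λ i j → grid i j ≡ s
    on-grid (s∈S , _ , pred∉S , suc∉S) with x , y , refl ← InS⇒representation s∈S =
      isolated-on-grid x y pred∉S suc∉S
    isolated : (∃₂ λ i j → grid i j ≡ s) → InT p q F s
    isolated (i , j , refl) =
      let pred∉S , suc∉S = grid-isolated i j
      in from InS-+ (toℕ i , toℕ j , refl) , below-Frobenius frobenius suc∉S , pred∉S , suc∉S

  InT-card : ∀ {F} → IsFrobenius p q F → HasCard (InT p q F) (m · k)
  InT-card frobenius = HasCard-image grid grid-injective (InT⇔grid frobenius)

m-n≡1⇒m≡1+n : ∀ m n → + m ℤ.- + n ≡ + 1 → m ≡ suc n
m-n≡1⇒m≡1+n m n eq = ℤ.+-injective (begin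
  + m                    ≡⟨ [i-j]+j≡i (+ m) (+ n) ⟨
  (+ m ℤ.- + n) ℤ.+ + n  ≡⟨ cong (ℤ._+ + n) eq ⟩
  + 1 ℤ.+ + n            ∎)
  where
  open ≡-Reasoning
  [i-j]+j≡i : ∀ i j → (i ℤ.- j) ℤ.+ j ≡ i
  [i-j]+j≡i = solve-∀

combination≢1 : ∀ {a b} x y → 1 < a → 1 < b → a · x + b · y ≢ 1
combination≢1 {a} {b} zero    y _   1<b eq =
  <⇒≢ 1<b (sym (m*n≡1⇒m≡1 b y (trans (sym (cong (_+ b · y) (*-zeroʳ a))) eq)))
combination≢1 {a} {b} (suc x) y 1<a _   eq =
  <⇒≱ 1<a (≤-trans (m≤m*n a (suc x)) (≤-trans (m≤m+n (a · suc x) (b · y)) (≤-reflexive eq)))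

-- + a * u reduces to sign u ◃ a · ∣ u ∣.
opposite-signs : ∀ {a b} u v → 1 < a → 1 < b → + a * u ℤ.+ + b * v ≡ + 1 →
                 a · ∣ u ∣ ≡ suc (b · ∣ v ∣) ⊎ b · ∣ v ∣ ≡ suc (a · ∣ u ∣)
opposite-signs {a} {b} (+ x) (+ y) 1<a 1<b eq = contradiction
  (ℤ.abs-cong {Sign.+} {a · x + b · y} {Sign.+} {1}
    (trans (ℤ.◃-distrib-+ Sign.+ (a · x) (b · y)) eq))
  (combination≢1 x y 1<a 1<b)
opposite-signs {a} {b} (+ x) -[1+ y ] _ _ eq = inj₁ (m-n≡1⇒m≡1+n (a · x) (b · suc y)
  (trans (cong₂ ℤ._+_ (sym (ℤ.+◃n≡+n (a · x))) (sym (ℤ.-◃n≡-n (b · suc y)))) eq))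
opposite-signs {a} {b} -[1+ x ] (+ y) _ _ eq = inj₂ (m-n≡1⇒m≡1+n (b · y) (a · suc x)
  (trans (cong₂ ℤ._+_ (sym (ℤ.+◃n≡+n (b · y))) (sym (ℤ.-◃n≡-n (a · suc x))))
         (trans (ℤ.+-comm (Sign.+ ℤ.◃ b · y) (Sign.- ℤ.◃ a · suc x)) eq)))
opposite-signs {a} {b} -[1+ x ] -[1+ y ] 1<a 1<b eq = contradiction
  (ℤ.abs-cong {Sign.-} {a · suc x + b · suc y} {Sign.+} {1}
    (trans (ℤ.◃-distrib-+ Sign.- (a · suc x) (b · suc y)) eq))
  (combination≢1 (suc x) (suc y) 1<a 1<b)

m≤∣m⊖n∣⇒m+m≤n : ∀ {m n} → 0 < n → m ≤ ∣ m ⊖ n ∣ → m + m ≤ n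
m≤∣m⊖n∣⇒m+m≤n {m} {n} 0<n m≤∣m⊖n∣ with ≤-total m n
... | inj₁ m≤n = subst (m + m ≤_) (m+[n∸m]≡n m≤n) (+-monoʳ-≤ m (subst (m ≤_) (ℤ.∣⊖∣-≤ m≤n) m≤∣m⊖n∣))
... | inj₂ n≤m = contradiction (subst (m ≤_) (trans (ℤ.∣m⊖n∣≡∣n⊖m∣ m n) (ℤ.∣⊖∣-≤ n≤m)) m≤∣m⊖n∣)
                               (<⇒≱ (∸-monoʳ-< 0<n n≤m))

∣i∣≤∣i±n∣⇒2∣i∣≤n : ∀ {n} i → 0 < n →
                   ∣ i ∣ ≤ ∣ i ℤ.- + n ∣ → ∣ i ∣ ≤ ∣ i ℤ.+ + n ∣ → ∣ i ∣ + ∣ i ∣ ≤ n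
∣i∣≤∣i±n∣⇒2∣i∣≤n {n} (+ x)    0<n ≤∣i-n∣ _ =
  m≤∣m⊖n∣⇒m+m≤n 0<n (subst (x ≤_) (cong ∣_∣ (ℤ.m-n≡m⊖n x n)) ≤∣i-n∣)
∣i∣≤∣i±n∣⇒2∣i∣≤n {n} -[1+ x ] 0<n _ ≤∣i+n∣ =
  m≤∣m⊖n∣⇒m+m≤n 0<n (subst (suc x ≤_) (ℤ.∣m⊖n∣≡∣n⊖m∣ n (suc x)) ≤∣i+n∣)

DefinitelyLeast⇒2∣u∣≤b×2∣v∣≤a : ∀ {a b u v} → 0 < a → 0 < b → DefinitelyLeast a b u v →
                                ∣ u ∣ + ∣ u ∣ ≤ b × ∣ v ∣ + ∣ v ∣ ≤ a
DefinitelyLeast⇒2∣u∣≤b×2∣v∣≤a {a} {b} {u} {v} 0<a 0<b (bezout , least) =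
  ∣i∣≤∣i±n∣⇒2∣i∣≤n u 0<b (proj₁ shifted-down) (proj₁ shifted-up) ,
  ∣i∣≤∣i±n∣⇒2∣i∣≤n v 0<a (proj₂ shifted-up) (proj₂ shifted-down)
  where
  shift-down : ∀ i j x y → i * (x ℤ.- j) ℤ.+ j * (y ℤ.+ i) ≡ i * x ℤ.+ j * y
  shift-down = solve-∀
  shift-up : ∀ i j x y → i * (x ℤ.+ j) ℤ.+ j * (y ℤ.- i) ≡ i * x ℤ.+ j * y
  shift-up = solve-∀
  shifted-down : ∣ u ∣ ≤ ∣ u ℤ.- + b ∣ × ∣ v ∣ ≤ ∣ v ℤ.+ + a ∣
  shifted-down = least (u ℤ.- + b) (v ℤ.+ + a) (trans (shift-down (+ a) (+ b) u v) bezout)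
  shifted-up : ∣ u ∣ ≤ ∣ u ℤ.+ + b ∣ × ∣ v ∣ ≤ ∣ v ℤ.- + a ∣
  shifted-up = least (u ℤ.+ + b) (v ℤ.- + a) (trans (shift-up (+ a) (+ b) u v) bezout)

lemma3p3 : (a b : ℕ) → Coprime a b → 1 < a → a < b →
    (u v : ℤ) → DefinitelyLeast a b u v →
    (F : ℤ) → IsFrobenius a b F →
    HasCard (InT a b F) ∣ u * v ∣
lemma3p3 a b coprime 1<a a<b u v least F frobenius
  with 2∣u∣≤b , 2∣v∣≤a ←
         DefinitelyLeast⇒2∣u∣≤b×2∣v∣≤a (<-trans z<s 1<a) (<-trans (<-trans z<s 1<a) a<b) least
  with opposite-signs u v 1<a (<-trans 1<a a<b) (proj₁ least)
... | inj₁ a∣u∣≡1+b∣v∣ =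
  subst (HasCard (InT a b F)) (sym (ℤ.abs-* u v))
    (BalancedBezout.InT-card coprime a∣u∣≡1+b∣v∣ 2∣u∣≤b 2∣v∣≤a frobenius)
... | inj₂ b∣v∣≡1+a∣u∣ =
  subst (HasCard (InT a b F)) (trans (*-comm ∣ v ∣ ∣ u ∣) (sym (ℤ.abs-* u v)))
    (HasCard-cong (λ s → mk⇔ InT-comm InT-comm)
      (BalancedBezout.InT-card (coprime-sym coprime) b∣v∣≡1+a∣u∣ 2∣v∣≤a 2∣u∣≤b
        (IsFrobenius-comm frobenius)))
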